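{- For every theory $\Gamma$ and every sentence $\varphi$ of $\mathcal{L}_{3.5}$: $\Gamma\models\varphi$ if and only if $\Gamma\vdash\varphi$.
   Context: Syntax of $\mathcal{L}_{3.5}$. Fix a set $P$ of nouns and a set $R$ of verbs. Terms: every noun $p\in P$ is a term; if $r\in R$ and $x$ is a term then $(r\ \mathsf{all}\ x)$ and $(r\ \mathsf{some}\ x)$ are terms. Sentences: $(\mathsf{all}\ x\ y)$ and $(\mathsf{some}\ x\ y)$ for terms $x,y$. A theory is a set of sentences. Semantics. A model $\mathcal{M}$ is a set $M$ (possibly empty) with $[\![p]\!]\subseteq M$ for $p\in P$ and $[\![r]\!]\subseteq M\times M$ for $r\in R$; $[\![r\ \mathsf{all}\ x]\!]=\{m\in M: m\,[\![r]\!]\,n\text{ for all }n\in[\![x]\!]\}$; $[\![r\ \mathsf{some}\ x]\!]=\{m\in M: m\,[\![r]\!]\,n\text{ for some }n\in[\![x]\!]\}$. $\mathcal{M}\models(\mathsf{all}\ x\ y)$ iff $[\![x]\!]\subseteq[\![y]\!]$; $\mathcal{M}\models(\mathsf{some}\ x\ y)$ iff $[\![x]\!]\cap[\![y]\!]\neq\emptyset$. $\Gamma\models\varphi$ means every model of $\Gamma$ satisfies $\varphi$. Provability $\Gamma\vdash\varphi$ is defined by finite derivations using the following rules (for all terms $x,y,z$, verbs $r$, sentences $\varphi$), with non-withdrawn assumptions in $\Gamma$: infer $(\mathsf{all}\ x\ x)$ from no premises; from $(\mathsf{all}\ x\ y)$, $(\mathsf{all}\ y\ z)$ infer $(\mathsf{all}\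 x\ z)$; from $(\mathsf{all}\ x\ y)$ infer $(\mathsf{all}\ (r\ \mathsf{all}\ y)\ (r\ \mathsf{all}\ x))$; from $(\mathsf{some}\ x\ y)$ infer $(\mathsf{some}\ x\ x)$; from $(\mathsf{some}\ x\ y)$ infer $(\mathsf{some}\ y\ x)$; from $(\mathsf{some}\ x\ y)$, $(\mathsf{all}\ y\ z)$ infer $(\mathsf{some}\ x\ z)$; from $(\mathsf{all}\ x\ y)$ infer $(\mathsf{all}\ (r\ \mathsf{some}\ x)\ (r\ \mathsf{some}\ y))$; from $(\mathsf{some}\ x\ y)$ infer $(\mathsf{all}\ (r\ \mathsf{all}\ x)\ (r\ \mathsf{some}\ y))$; from $(\mathsf{some}\ x\ (r\ \mathsf{some}\ y))$ infer $(\mathsf{some}\ y\ y)$; first cases rule: given a derivation of $\varphi$ from $\Gamma\cup\{(\mathsf{some}\ x\ x)\}$ and a derivation of $\varphi$ from $\Gamma\cup\{(\mathsf{all}\ y\ (r\ \mathsf{all}\ x))\}$, conclude $\varphi$ from $\Gamma$; second cases rule: given a derivation of $\varphi$ from $\Gamma\cup\{(\mathsf{some}\ x\ x)\}$ and a derivation of $\varphi$ from $\Gamma\cup\{(\mathsf{all}\ x\ y)\}$, conclude $\varphi$ from $\Gamma$. (In the cases rules the displayed extra assumptions are withdrawn, zero or more occurrences.) -}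

module Defs where

open import Level using (Level; suc)
open import Data.Product using (∃-syntax; _×_)
open import Relation.Binary.Core using (Rel)
open import Relation.Unary using (Pred; _∈_; _⊆_; _∩_; _∪_; ｛_｝; Satisfiable)

data Term {ℓ : Level} (P R : Set ℓ) : Set ℓ where
  noun   : P → Term P R
  _·all_  : R → Term P R → Term P R
  _·some_ : R → Term P R → Term P R

data Sentence {ℓ : Level} (P R : Set ℓ) : Set ℓ where
  all  : Term P R → Term P R → Sentence P R
  some : Term P R → Term P R → Sentence P R

Theory : {ℓ : Level} → Set ℓ → Set ℓ → Set (suc ℓ)
Theory {ℓ} P R = Pred (Sentence P R) ℓ

record Model {ℓ : Level} (P R : Set ℓ) : Set (suc ℓ) where
  field
    Carrier : Set ℓ
    nounᴹ   : P → Pred Carrier ℓ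
    verbᴹ   : R → Rel Carrier ℓ

  ⟦_⟧ : Term P R → Pred Carrier ℓ
  ⟦ noun p ⟧    = nounᴹ p
  ⟦ r ·all x ⟧  = λ m → ∀ n → n ∈ ⟦ x ⟧ → verbᴹ r m n
  ⟦ r ·some x ⟧ = λ m → ∃[ n ] (n ∈ ⟦ x ⟧ × verbᴹ r m n)

infix 4 _⊨ᴹ_ _⊨_ _⊢_

_⊨ᴹ_ : {ℓ : Level} {P R : Set ℓ} → Model P R → Sentence P R → Set ℓ
M ⊨ᴹ all x y  = Model.⟦_⟧ M x ⊆ Model.⟦_⟧ M y
M ⊨ᴹ some x y = Satisfiable (Model.⟦_⟧ M x ∩ Model.⟦_⟧ M y)

_⊨_ : {ℓ : Level} {P R : Set ℓ} → Theory P R → Sentence P R → Set (suc ℓ)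
_⊨_ {P = P} {R} Γ φ = (M : Model P R) → (∀ ψ → ψ ∈ Γ → M ⊨ᴹ ψ) → M ⊨ᴹ φ

-- Γ is the set of assumptions still available, so withdrawing an assumption
-- (any number of occurrences, possibly none) is returning from Γ ∪ ｛ ψ ｝ to Γ.
data _⊢_ {ℓ : Level} {P R : Set ℓ} (Γ : Theory P R) : Sentence P R → Set ℓ where
  assumption : ∀ {φ} → φ ∈ Γ → Γ ⊢ φ
  axiom      : ∀ {x} → Γ ⊢ all x x
  barbara    : ∀ {x y z} → Γ ⊢ all x y → Γ ⊢ all y z → Γ ⊢ all x z
  anti       : ∀ {x y} r → Γ ⊢ all x y → Γ ⊢ all (r ·all y) (r ·all x)
  some₁      : ∀ {x y} → Γ ⊢ some x y → Γ ⊢ some x x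
  some₂      : ∀ {x y} → Γ ⊢ some x y → Γ ⊢ some y x
  darii      : ∀ {x y z} → Γ ⊢ some x y → Γ ⊢ all y z → Γ ⊢ some x z
  mono       : ∀ {x y} r → Γ ⊢ all x y → Γ ⊢ all (r ·some x) (r ·some y)
  all-some   : ∀ {x y} r → Γ ⊢ some x y → Γ ⊢ all (r ·all x) (r ·some y)
  some-verb  : ∀ {x y} r → Γ ⊢ some x (r ·some y) → Γ ⊢ some y y
  cases₁     : ∀ {φ} x y r →
               Γ ∪ ｛ some x x ｝ ⊢ φ → Γ ∪ ｛ all y (r ·all x) ｝ ⊢ φ → Γ ⊢ φ
  cases₂     : ∀ {φ} x y →
               Γ ∪ ｛ some x x ｝ ⊢ φ → Γ ∪ ｛ all x y ｝ ⊢ φ → Γ ⊢ φ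

{-# OPTIONS --safe #-}
module Submission where

-- Soundness is an induction on derivations; the two cases rules hold because
-- a term is interpreted by a set that is either inhabited or empty.
--
-- Completeness is proved by contraposition.  Suppose Γ does not prove φ.
--
-- * Derivations are finite, so non-provability of φ passes to unions of chains
--   (`compactness`), and Γ extends to a theory Δ that is maximal among those
--   not proving φ (`lindenbaum`).  The language may be uncountable, so this
--   step needs choice.  Excluded middle for all types, and not only for
--   propositions, provides it: it picks an element of every type that is not
--   empty.  The maximal set is obtained by Zermelo's argument: the least family
--   of subsets closed under unions and under adjoining a chosen admissible
--   element is a chain, and its union is maximal (`maximal-subset`).
--
-- * Because of the cases rules, Δ decides existence (`Decisive`): for
--   each term x, either Δ proves (some x x), or Δ treats x as empty, that is,
--   it proves (all x y) and (all y (r all x)) for all y and r.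
--
-- * A decisive Δ has a canonical model.  Its points are the pairs of
--   terms (a , b) with Δ proving (some a b), each in two copies, and the
--   point (a , b) lies in x exactly when Δ proves (all a x) or (all b x)
--   (`from-⟦⟧`, `to-⟦⟧`).  The model satisfies exactly the sentences that Δ
--   proves (`canonical-sound`, `canonical-complete`), hence Γ but not φ.

open import Defs
open import Level using (Level; _⊔_; 0ℓ)
open import Function.Base using (_∘_; id)
open import Function.Bundles using (_⇔_; mk⇔)
open import Axiom.ExcludedMiddle using (ExcludedMiddle)
open import Axiom.Extensionality.Propositional using (Extensionality)
open import Data.Bool.Base using (Bool; true; false)
open import Data.Bool.Properties using (⇔→≡)
open import Data.Empty using (⊥-elim)
open import Data.Product using (∃; ∃-syntax; _×_; _,_; proj₁; proj₂)
open import Data.Sum using (_⊎_; inj₁; inj₂; [_,_]; map₁)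
open import Relation.Nullary using (¬_; Dec; yes; no; does)
open import Relation.Nullary.Decidable using (decidable-stable)
open import Relation.Binary.PropositionalEquality using (_≡_; refl)
open import Relation.Unary using (Pred; _∈_; _⊆_; _∪_; ｛_｝)

-- Structural properties of derivations

module _ {ℓ : Level} {P R : Set ℓ} where

  weaken : {Γ Δ : Theory P R} {φ : Sentence P R} → Γ ⊆ Δ → Γ ⊢ φ → Δ ⊢ φ
  weaken s (assumption h)     = assumption (s h)
  weaken s axiom              = axiom
  weaken s (barbara d e)      = barbara (weaken s d) (weaken s e)
  weaken s (anti r d)         = anti r (weaken s d)
  weaken s (some₁ d)          = some₁ (weaken s d)
  weaken s (some₂ d)          = some₂ (weaken s d)
  weaken s (darii d e)        = darii (weaken s d) (weaken s e)
  weaken s (mono r d)         = mono r (weaken s d)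
  weaken s (all-some r d)     = all-some r (weaken s d)
  weaken s (some-verb r d)    = some-verb r (weaken s d)
  weaken s (cases₁ x y r d e) =
    cases₁ x y r (weaken (map₁ s) d) (weaken (map₁ s) e)
  weaken s (cases₂ x y d e)   =
    cases₂ x y (weaken (map₁ s) d) (weaken (map₁ s) e)

  -- Directed under inclusion; I may be empty.
  Directed : {I : Set ℓ} → (I → Theory P R) → Set ℓ
  Directed {I} D = ∀ i j → ∃[ k ] (D i ⊆ D k × D j ⊆ D k)

  directed-∪ : {I : Set ℓ} {D : I → Theory P R} (ψ : Sentence P R) →
               Directed D → Directed (λ i → D i ∪ ｛ ψ ｝)
  directed-∪ ψ dir i j with dir i j
  ... | k , p , q = k , map₁ p , map₁ q

  -- The theory Γ is kept apart from the union that contains it, so that the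
  -- induction hypothesis applies to the extended theories of the cases rules.
  compactness : {I : Set ℓ} (D : I → Theory P R) → Directed D → I →
                {Γ : Theory P R} {φ : Sentence P R} →
                Γ ⊆ (λ ψ → ∃[ i ] ψ ∈ D i) → Γ ⊢ φ → ∃[ i ] D i ⊢ φ

  compactness-∪ : {I : Set ℓ} (D : I → Theory P R) → Directed D → I →
                  {Γ : Theory P R} {φ ψ : Sentence P R} →
                  Γ ⊆ (λ χ → ∃[ i ] χ ∈ D i) →
                  Γ ∪ ｛ ψ ｝ ⊢ φ → ∃[ i ] D i ∪ ｛ ψ ｝ ⊢ φ

  compactness D dir i s (assumption h) with s h
  ... | j , h′ = j , assumption h′
  compactness D dir i s axiom = i , axiom
  compactness D dir i s (barbara d e)
    with compactness D dir i s d | compactness D dir i s e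
  ... | j , d′ | k , e′ with dir j k
  ...   | l , p , q = l , barbara (weaken p d′) (weaken q e′)
  compactness D dir i s (anti r d) with compactness D dir i s d
  ... | j , d′ = j , anti r d′
  compactness D dir i s (some₁ d) with compactness D dir i s d
  ... | j , d′ = j , some₁ d′
  compactness D dir i s (some₂ d) with compactness D dir i s d
  ... | j , d′ = j , some₂ d′
  compactness D dir i s (darii d e)
    with compactness D dir i s d | compactness D dir i s e
  ... | j , d′ | k , e′ with dir j k
  ...   | l , p , q = l , darii (weaken p d′) (weaken q e′)
  compactness D dir i s (mono r d) with compactness D dir i s d
  ... | j , d′ = j , mono r d′
  compactness D dir i s (all-some r d) with compactness D dir i s d
  ... | j , d′ = j , all-some r d′
  compactness D dir i s (some-verb r d) with compactness D dir i s d
  ... | j , d′ = j , some-verb r d′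
  compactness D dir i s (cases₁ x y r d e)
    with compactness-∪ D dir i s d | compactness-∪ D dir i s e
  ... | j , d′ | k , e′ with dir j k
  ...   | l , p , q =
    l , cases₁ x y r (weaken (map₁ p) d′) (weaken (map₁ q) e′)
  compactness D dir i s (cases₂ x y d e)
    with compactness-∪ D dir i s d | compactness-∪ D dir i s e
  ... | j , d′ | k , e′ with dir j k
  ...   | l , p , q =
    l , cases₂ x y (weaken (map₁ p) d′) (weaken (map₁ q) e′)

  compactness-∪ D dir i {ψ = ψ} s =
    compactness (λ j → D j ∪ ｛ ψ ｝) (directed-∪ ψ dir) i
      [ (λ h → proj₁ (s h) , inj₁ (proj₂ (s h))) , (λ h → i , inj₂ h) ]

-- Maximal subsets

-- Subsets are Bool-valued, so that those of a type in `Set a` again form a type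
-- in `Set a`; unions of arbitrary families of subsets are then subsets.
Subset : {a : Level} → Set a → Set a
Subset A = A → Bool

⟨_⟩ : {a : Level} {A : Set a} → Subset A → Pred A 0ℓ
⟨ X ⟩ a = X a ≡ true

Chain : {a : Level} {A : Set a} → Subset (Subset A) → Set a
Chain F = ∀ {X Y} → X ∈ ⟨ F ⟩ → Y ∈ ⟨ F ⟩ → ⟨ X ⟩ ⊆ ⟨ Y ⟩ ⊎ ⟨ Y ⟩ ⊆ ⟨ X ⟩

module Classical (em : ∀ {a : Level} → ExcludedMiddle a)
                 (ext : ∀ {a b : Level} → Extensionality a b) where

  stable : {a : Level} {A : Set a} → ¬ ¬ A → A
  stable = decidable-stable em

  ⊆-antisym : {a : Level} {A : Set a} {X Y : Subset A} →
              ⟨ X ⟩ ⊆ ⟨ Y ⟩ → ⟨ Y ⟩ ⊆ ⟨ X ⟩ → X ≡ Y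
  ⊆-antisym p q = ext λ a → ⇔→≡ (mk⇔ (p {a}) (q {a}))

  -- The subset of the elements that satisfy a predicate.
  ⌊_⌋ : {a b : Level} {A : Set a} → Pred A b → Subset A
  ⌊ Q ⌋ a = does (em {P = Q a})

  ⌊⌋-intro : {a b : Level} {A : Set a} (Q : Pred A b) → Q ⊆ ⟨ ⌊ Q ⌋ ⟩
  ⌊⌋-intro Q {a} h with em {P = Q a}
  ... | yes _ = refl
  ... | no ¬h = ⊥-elim (¬h h)

  ⌊⌋-elim : {a b : Level} {A : Set a} (Q : Pred A b) → ⟨ ⌊ Q ⌋ ⟩ ⊆ Q
  ⌊⌋-elim Q {a} h with em {P = Q a}
  ⌊⌋-elim Q h  | yes q = q
  ⌊⌋-elim Q () | no _

  -- The elements of some member of the family F.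
  Member : {a : Level} {A : Set a} → Subset (Subset A) → Pred A a
  Member F a = ∃[ X ] (X ∈ ⟨ F ⟩ × a ∈ ⟨ X ⟩)

  ⋃ : {a : Level} {A : Set a} → Subset (Subset A) → Subset A
  ⋃ F = ⌊ Member F ⌋

  ⊆-⋃ : {a : Level} {A : Set a} {F : Subset (Subset A)} {X : Subset A} →
        X ∈ ⟨ F ⟩ → ⟨ X ⟩ ⊆ ⟨ ⋃ F ⟩
  ⊆-⋃ {F = F} h a∈X = ⌊⌋-intro (Member F) (_ , h , a∈X)

  ⋃-least : {a b : Level} {A : Set a} {F : Subset (Subset A)} {Q : Pred A b} →
            (∀ X → X ∈ ⟨ F ⟩ → ⟨ X ⟩ ⊆ Q) → ⟨ ⋃ F ⟩ ⊆ Q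
  ⋃-least {F = F} h a∈⋃ with ⌊⌋-elim (Member F) a∈⋃
  ... | X , X∈F , a∈X = h X X∈F a∈X

  insert : {a : Level} {A : Set a} → A → Subset A → Subset A
  insert a X = ⌊ ⟨ X ⟩ ∪ ｛ a ｝ ⌋

  ⊆-insert : {a : Level} {A : Set a} (s : A) (X : Subset A) →
             ⟨ X ⟩ ⊆ ⟨ insert s X ⟩
  ⊆-insert s X h = ⌊⌋-intro (⟨ X ⟩ ∪ ｛ s ｝) (inj₁ h)

  ∈-insert : {a : Level} {A : Set a} (s : A) (X : Subset A) →
             s ∈ ⟨ insert s X ⟩
  ∈-insert s X = ⌊⌋-intro (⟨ X ⟩ ∪ ｛ s ｝) (inj₂ refl)

  insert-⊆ : {a : Level} {A : Set a} (s : A) (X : Subset A) →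
             ⟨ insert s X ⟩ ⊆ ⟨ X ⟩ ∪ ｛ s ｝
  insert-⊆ s X = ⌊⌋-elim (⟨ X ⟩ ∪ ｛ s ｝)

  module Zermelo {a c : Level} {A : Set a} (C : Pred (Subset A) c) where

    -- An admissible element: one outside X that can be adjoined within C.
    Extension : Subset A → Set (a ⊔ c)
    Extension X = ∃[ s ] (¬ s ∈ ⟨ X ⟩ × insert s X ∈ C)

    -- The decision is an argument so that proofs can split on it.  In `next` it
    -- comes from excluded middle, which thereby chooses the adjoined element.
    grow : (X : Subset A) → Dec (Extension X) → Subset A
    grow X (yes (s , _)) = insert s X
    grow X (no _)        = X

    next : Subset A → Subset A
    next X = grow X em

    grow-increasing : ∀ X d → ⟨ X ⟩ ⊆ ⟨ grow X d ⟩
    grow-increasing X (yes (s , _)) = ⊆-insert s X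
    grow-increasing X (no _)        = id

    increasing : ∀ X → ⟨ X ⟩ ⊆ ⟨ next X ⟩
    increasing X = grow-increasing X em

    grow-C : ∀ X d → X ∈ C → grow X d ∈ C
    grow-C X (yes (_ , _ , h)) _ = h
    grow-C X (no _)            h = h

    grow-fixed : ∀ X d → ⟨ grow X d ⟩ ⊆ ⟨ X ⟩ → ¬ Extension X
    grow-fixed X (yes (s , s∉X , _)) p _ = s∉X (p (∈-insert s X))
    grow-fixed X (no ¬e)             _   = ¬e

    -- The least family of subsets closed under `next` and under unions.
    data Tower : Subset A → Set a where
      step  : ∀ {X} → Tower X → Tower (next X)
      union : ∀ F → (∀ X → X ∈ ⟨ F ⟩ → Tower X) → Tower (⋃ F)

    -- A subset that no step of the tower jumps over from strictly below.
    Extreme : Subset A → Set a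
    Extreme X = ∀ {Y} → Tower Y → ⟨ Y ⟩ ⊆ ⟨ X ⟩ → ¬ ⟨ X ⟩ ⊆ ⟨ Y ⟩ →
                ⟨ next Y ⟩ ⊆ ⟨ X ⟩

    -- In the step case, extensionality settles Y = X, where next Y = next X.
    extreme-dichotomy : ∀ {X} → Extreme X → ∀ {Y} → Tower Y →
                        ⟨ Y ⟩ ⊆ ⟨ X ⟩ ⊎ ⟨ next X ⟩ ⊆ ⟨ Y ⟩
    extreme-dichotomy {X} ex (step {Y} t) with extreme-dichotomy ex t
    ... | inj₂ q = inj₂ (increasing Y ∘ q)
    ... | inj₁ p with em {P = ⟨ X ⟩ ⊆ ⟨ Y ⟩}
    ...   | no X⊈Y = inj₁ (ex t p X⊈Y)
    ...   | yes q with ⊆-antisym {X = Y} {Y = X} p q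
    ...     | refl = inj₂ id
    extreme-dichotomy {X} ex (union F ts)
      with em {P = ∃[ Y ] (Y ∈ ⟨ F ⟩ × ⟨ next X ⟩ ⊆ ⟨ Y ⟩)}
    ... | yes (Y , Y∈F , q) = inj₂ (⊆-⋃ Y∈F ∘ q)
    ... | no none = inj₁ (⋃-least below)
      where
      below : ∀ Y → Y ∈ ⟨ F ⟩ → ⟨ Y ⟩ ⊆ ⟨ X ⟩
      below Y Y∈F with extreme-dichotomy ex (ts Y Y∈F)
      ... | inj₁ p = p
      ... | inj₂ q = ⊥-elim (none (Y , Y∈F , q))

    all-extreme : ∀ {X} → Tower X → Extreme X
    all-extreme (step {X} t) {Y} u p ¬q with extreme-dichotomy (all-extreme t) u
    ... | inj₂ q = ⊥-elim (¬q q)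
    ... | inj₁ p′ with em {P = ⟨ X ⟩ ⊆ ⟨ Y ⟩}
    ...   | no X⊈Y = increasing X ∘ all-extreme t u p′ X⊈Y
    ...   | yes q with ⊆-antisym {X = Y} {Y = X} p′ q
    ...     | refl = id
    all-extreme (union F ts) {Y} u p ¬q
      with em {P = ∃[ Z ] (Z ∈ ⟨ F ⟩ × ¬ ⟨ Z ⟩ ⊆ ⟨ Y ⟩)}
    ... | no none =
      ⊥-elim (¬q (⋃-least λ Z Z∈F → stable λ Z⊈Y → none (Z , Z∈F , Z⊈Y)))
    ... | yes (Z , Z∈F , Z⊈Y) with extreme-dichotomy (all-extreme (ts Z Z∈F)) u
    ...   | inj₂ q = ⊥-elim (Z⊈Y (q ∘ increasing Z))
    ...   | inj₁ p′ = ⊆-⋃ Z∈F ∘ all-extreme (ts Z Z∈F) u p′ Z⊈Y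

    tower-linear : ∀ {X Y} → Tower X → Tower Y → ⟨ X ⟩ ⊆ ⟨ Y ⟩ ⊎ ⟨ Y ⟩ ⊆ ⟨ X ⟩
    tower-linear {X} t u with extreme-dichotomy (all-extreme t) u
    ... | inj₁ p = inj₂ p
    ... | inj₂ q = inj₁ (q ∘ increasing X)

    module _ (C-⋃ : ∀ F → Chain F → ⟨ F ⟩ ⊆ C → ⋃ F ∈ C) where

      tower-C : Tower ⊆ C
      tower-C (step t)     = grow-C _ em (tower-C t)
      tower-C (union F ts) =
        C-⋃ F (λ {X} {Y} h k → tower-linear (ts X h) (ts Y k))
              (λ {X} h → tower-C (ts X h))

      -- The union of the tower is itself in the tower, so `next` adds nothing
      -- to it: no admissible element remains.
      maximal : ∃[ X ] (X ∈ C × ¬ Extension X)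
      maximal = top , tower-C top-tower ,
                grow-fixed top em (⊆-⋃ (⌊⌋-intro Tower (step top-tower)))
        where
        top : Subset A
        top = ⋃ ⌊ Tower ⌋

        top-tower : Tower top
        top-tower = union _ (λ X → ⌊⌋-elim Tower)

  -- A form of Zorn's lemma.  The empty family counts as a chain, so the
  -- hypothesis includes that C holds of the empty subset.
  maximal-subset : {a c : Level} {A : Set a} (C : Pred (Subset A) c) →
                   (∀ F → Chain F → ⟨ F ⟩ ⊆ C → ⋃ F ∈ C) →
                   ∃[ X ] (X ∈ C × (∀ s → insert s X ∈ C → s ∈ ⟨ X ⟩))
  maximal-subset C C-⋃ with Zermelo.maximal C C-⋃
  ... | X , X∈C , ¬e = X , X∈C , λ s h → stable λ s∉X → ¬e (s , s∉X , h)

-- The canonical model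

module _ {ℓ : Level} {P R : Set ℓ} where

  -- Every term is provably inhabited or is treated as empty, in the sense that
  -- Δ proves the sentences that the cases rules offer when x is empty.
  Decisive : Theory P R → Set ℓ
  Decisive Δ = ∀ x → Δ ⊢ some x x ⊎
                     ((∀ y → Δ ⊢ all x y) × (∀ r y → Δ ⊢ all y (r ·all x)))

module Canonical {ℓ : Level} {P R : Set ℓ} (Δ : Theory P R)
                 (dec : Decisive Δ) where

  -- Points carry a tag.  Two copies are needed because Δ may prove
  -- (all a (r some x)) without (all a (r all x)): a point (a , b) must then be
  -- related to some point of x but not to all of them.  The points that
  -- witness a sentence about (r some x) are those tagged true.
  record Point : Set ℓ where
    constructor point
    field
      left right : Term P R
      tag        : Bool
      witness    : Δ ⊢ some left right

  open Point

  infix 4 _⊑_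

  -- Membership of a point in a term, expressed by provability.
  _⊑_ : Point → Term P R → Set ℓ
  m ⊑ x = Δ ⊢ all (left m) x ⊎ Δ ⊢ all (right m) x

  ⊑-trans : ∀ {x y} m → m ⊑ x → Δ ⊢ all x y → m ⊑ y
  ⊑-trans m (inj₁ d) e = inj₁ (barbara d e)
  ⊑-trans m (inj₂ d) e = inj₂ (barbara d e)

  ⊑-some : ∀ {x y} m → m ⊑ x → m ⊑ y → Δ ⊢ some x y
  ⊑-some m (inj₁ d) (inj₁ e) = darii (some₂ (darii (some₁ (witness m)) d)) e
  ⊑-some m (inj₁ d) (inj₂ e) = darii (some₂ (darii (some₂ (witness m)) d)) e
  ⊑-some m (inj₂ d) (inj₁ e) = darii (some₂ (darii (witness m) d)) e
  ⊑-some m (inj₂ d) (inj₂ e) =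
    darii (some₂ (darii (some₁ (some₂ (witness m))) d)) e

  -- The verb r relates m to n when m lies in (r all c) for a component c of n.
  -- The last clause adds witnesses: if m lies in (r some c), it is related to the
  -- points tagged true whose left component is c.
  data Related (r : R) (m n : Point) : Set ℓ where
    via-left  : m ⊑ r ·all left n → Related r m n
    via-right : m ⊑ r ·all right n → Related r m n
    via-some  : tag n ≡ true → left n ≡ right n → m ⊑ r ·some left n →
                Related r m n

  model : Model P R
  model = record
    { Carrier = Point
    ; nounᴹ   = λ p m → m ⊑ noun p
    ; verbᴹ   = Related
    }

  open Model model using (⟦_⟧)

  related-all : ∀ {r x} m n → m ⊑ r ·all x → n ⊑ x → Related r m n
  related-all {r} m n h (inj₁ d) = via-left (⊑-trans m h (anti r d))
  related-all {r} m n h (inj₂ d) = via-right (⊑-trans m h (anti r d))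

  related-some : ∀ {r x} m n → n ⊑ x → Related r m n → m ⊑ r ·some x
  related-some {r} m n h (via-left g) =
    ⊑-trans m g (all-some r (⊑-some n (inj₁ axiom) h))
  related-some {r} m n h (via-right g) =
    ⊑-trans m g (all-some r (⊑-some n (inj₂ axiom) h))
  related-some {r} m (point c .c _ _) h (via-some _ refl g) =
    ⊑-trans m g (mono r ([ id , id ] h))

  -- The truth lemma: `⟦ x ⟧` consists of the points m with m ⊑ x.  The two
  -- directions depend on each other at the argument of an r-all term.
  from-⟦⟧ : ∀ x m → m ∈ ⟦ x ⟧ → m ⊑ x
  to-⟦⟧   : ∀ x m → m ⊑ x → m ∈ ⟦ x ⟧

  from-⟦⟧ (noun p) m h = h
  from-⟦⟧ (r ·all x) m h with dec x
  ... | inj₂ (_ , e) = inj₁ (e r (left m))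
  -- The copy of (x , x) tagged false is related to m only by an r-all term.
  ... | inj₁ d
    with h (point x x false d) (to-⟦⟧ x (point x x false d) (inj₁ axiom))
  ...   | via-left g      = g
  ...   | via-right g     = g
  ...   | via-some () _ _
  from-⟦⟧ (r ·some x) m (n , n∈x , rel) = related-some m n (from-⟦⟧ x n n∈x) rel

  to-⟦⟧ (noun p) m h = h
  to-⟦⟧ (r ·all x) m h n n∈x = related-all m n h (from-⟦⟧ x n n∈x)
  to-⟦⟧ (r ·some x) m h = n , to-⟦⟧ x n (inj₁ axiom) , via-some refl refl h
    where
    n : Point
    n = point _ _ true (some-verb r (⊑-some m (inj₁ axiom) h))

  canonical-sound : ∀ ψ → Δ ⊢ ψ → model ⊨ᴹ ψ
  canonical-sound (all x y) d {m} h = to-⟦⟧ y m (⊑-trans m (from-⟦⟧ x m h) d)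
  canonical-sound (some x y) d =
    m , to-⟦⟧ x m (inj₁ axiom) , to-⟦⟧ y m (inj₂ axiom)
    where
    m : Point
    m = point _ _ false d

  canonical-complete : ∀ ψ → model ⊨ᴹ ψ → Δ ⊢ ψ
  canonical-complete (all x y) h with dec x
  ... | inj₂ (e , _) = e y
  ... | inj₁ d = [ id , id ] (from-⟦⟧ y m (h (to-⟦⟧ x m (inj₁ axiom))))
    where
    m : Point
    m = point _ _ false d
  canonical-complete (some x y) (m , m∈x , m∈y) =
    ⊑-some m (from-⟦⟧ x m m∈x) (from-⟦⟧ y m m∈y)

-- Soundness and completeness

module Completeness (em : ∀ {a : Level} → ExcludedMiddle a)
                    (ext : ∀ {a b : Level} → Extensionality a b)
                    {ℓ : Level} {P R : Set ℓ} where

  open Classical em ext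

  sound : {Γ : Theory P R} {φ : Sentence P R} → Γ ⊢ φ → Γ ⊨ φ

  sound-∪ : {Γ : Theory P R} {φ ψ : Sentence P R} → Γ ∪ ｛ ψ ｝ ⊢ φ →
            (M : Model P R) → (∀ χ → χ ∈ Γ → M ⊨ᴹ χ) → M ⊨ᴹ ψ → M ⊨ᴹ φ
  sound-∪ d M hΓ hψ = sound d M λ where
    χ (inj₁ h)    → hΓ χ h
    χ (inj₂ refl) → hψ

  sound (assumption h) M hΓ = hΓ _ h
  sound axiom M hΓ = id
  sound (barbara d e) M hΓ h = sound e M hΓ (sound d M hΓ h)
  sound (anti r d) M hΓ h n n∈x = h n (sound d M hΓ n∈x)
  sound (some₁ d) M hΓ with sound d M hΓ
  ... | m , p , q = m , p , p
  sound (some₂ d) M hΓ with sound d M hΓ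
  ... | m , p , q = m , q , p
  sound (darii d e) M hΓ with sound d M hΓ
  ... | m , p , q = m , p , sound e M hΓ q
  sound (mono r d) M hΓ (n , n∈x , rel) = n , sound d M hΓ n∈x , rel
  sound (all-some r d) M hΓ h with sound d M hΓ
  ... | m , p , q = m , q , h m p
  sound (some-verb r d) M hΓ with sound d M hΓ
  ... | _ , _ , n , n∈y , _ = n , n∈y , n∈y
  sound (cases₁ x y r d e) M hΓ with em {P = M ⊨ᴹ some x x}
  ... | yes h = sound-∪ d M hΓ h
  ... | no ¬h = sound-∪ e M hΓ λ _ n n∈x → ⊥-elim (¬h (n , n∈x , n∈x))
  sound (cases₂ x y d e) M hΓ with em {P = M ⊨ᴹ some x x}
  ... | yes h = sound-∪ d M hΓ h
  ... | no ¬h = sound-∪ e M hΓ λ {n} n∈x → ⊥-elim (¬h (n , n∈x , n∈x))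

  -- The last component is maximality: a sentence that can be adjoined to Δ
  -- without making φ provable is already provable from Δ.
  lindenbaum : (Γ : Theory P R) (φ : Sentence P R) → ¬ Γ ⊢ φ →
               ∃[ Δ ] (Γ ⊆ Δ × ¬ Δ ⊢ φ × (∀ ψ → ¬ Δ ∪ ｛ ψ ｝ ⊢ φ → Δ ⊢ ψ))
  lindenbaum Γ φ ¬Γ⊢φ with maximal-subset C C-⋃
    where
    C : Pred (Subset (Sentence P R)) ℓ
    C X = ¬ Γ ∪ ⟨ X ⟩ ⊢ φ

    C-⋃ : ∀ F → Chain F → ⟨ F ⟩ ⊆ C → ⋃ F ∈ C
    C-⋃ F chain F⊆C d with em {P = ∃ ⟨ F ⟩}
    -- The union of the empty chain adds nothing to Γ.
    ... | no empty =
      ¬Γ⊢φ (weaken [ id , ⊥-elim ∘ ⋃-least (λ X h → ⊥-elim (empty (X , h))) ] d)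
    ... | yes X₀ with compactness {I = ∃ ⟨ F ⟩} D directed X₀ cover d
      where
      D : ∃ ⟨ F ⟩ → Theory P R
      D (X , _) = Γ ∪ ⟨ X ⟩

      directed : Directed D
      directed (X , h) (Y , k) with chain h k
      ... | inj₁ p = (Y , k) , [ inj₁ , inj₂ ∘ p ] , id
      ... | inj₂ q = (X , h) , id , [ inj₁ , inj₂ ∘ q ]

      cover : Γ ∪ ⟨ ⋃ F ⟩ ⊆ (λ ψ → ∃[ i ] ψ ∈ D i)
      cover (inj₁ h) = X₀ , inj₁ h
      cover (inj₂ h) with ⌊⌋-elim (Member F) h
      ... | X , X∈F , ψ∈X = (X , X∈F) , inj₂ ψ∈X
    ...   | (X , X∈F) , d′ = F⊆C X∈F d′
  ... | X , ¬d , max = Γ ∪ ⟨ X ⟩ , inj₁ , ¬d , λ ψ ¬e →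
    assumption (inj₂ (max ψ λ e → ¬e (weaken (split ψ) e)))
    where
    split : ∀ ψ → Γ ∪ ⟨ insert ψ X ⟩ ⊆ (Γ ∪ ⟨ X ⟩) ∪ ｛ ψ ｝
    split ψ = [ inj₁ ∘ inj₁ , map₁ inj₂ ∘ insert-⊆ ψ X ]

  -- If adjoining (some x x) makes φ provable then, by the cases rules, no
  -- sentence saying that x is treated as empty does, so maximality puts all of
  -- these into Δ.
  maximal-decisive : {Δ : Theory P R} {φ : Sentence P R} → ¬ Δ ⊢ φ →
                     (∀ ψ → ¬ Δ ∪ ｛ ψ ｝ ⊢ φ → Δ ⊢ ψ) → Decisive Δ
  maximal-decisive {Δ} {φ} ¬d max x with em {P = Δ ∪ ｛ some x x ｝ ⊢ φ}
  ... | no ¬e = inj₁ (max (some x x) ¬e)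
  ... | yes e = inj₂ ( (λ y → max _ λ d → ¬d (cases₂ x y e d))
                     , (λ r y → max _ λ d → ¬d (cases₁ x y r e d)))

  complete : {Γ : Theory P R} {φ : Sentence P R} → Γ ⊨ φ → Γ ⊢ φ
  complete {Γ} {φ} Γ⊨φ = stable λ ¬Γ⊢φ → refute (lindenbaum Γ φ ¬Γ⊢φ)
    where
    refute : ¬ (∃[ Δ ] (Γ ⊆ Δ × ¬ Δ ⊢ φ × (∀ ψ → ¬ Δ ∪ ｛ ψ ｝ ⊢ φ → Δ ⊢ ψ)))
    refute (Δ , Γ⊆Δ , ¬Δ⊢φ , max) =
      ¬Δ⊢φ (canonical-complete φ
        (Γ⊨φ model λ ψ h → canonical-sound ψ (assumption (Γ⊆Δ h))))
      where open Canonical Δ (maximal-decisive ¬Δ⊢φ max)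

theorem3p5 : (∀ {a : Level} → ExcludedMiddle a) →
    (∀ {a b : Level} → Extensionality a b) →
    ∀ {ℓ : Level} {P R : Set ℓ} (Γ : Theory P R) (φ : Sentence P R) →
    (Γ ⊨ φ) ⇔ (Γ ⊢ φ)
theorem3p5 em ext Γ φ = mk⇔ complete sound
  where open Completeness em ext
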